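{- Let $\Sigma$ be a finite alphabet and let $L\subseteq\Sigma^*$ be the language of unique Eulerian trails. Let $L''\subseteq\Sigma^*$ be the set of words $r$ of one of the two forms (a) $r=axbzayb$ with $a,b\in\Sigma$, $a\neq b$, $x,y,z\in\Sigma^*$, or (b) $r=axaya$ with $a\in\Sigma$, $x,y\in\Sigma^*$ (and $z=\epsilon$ in the conditions below), satisfying: (1) $x\neq\epsilon$ or $y\neq\epsilon$; (2) $x,y,z\in L$; (3) none of $x,y,z$ contains the letter $a$ or the letter $b$, and no two of $x,y,z$ contain a common letter. Then $L''$ equals the set of minimal forbidden words of $L$.
   Context: For a word $t=t_1\cdots t_n$ over $\Sigma$ (viewed as a vertex set), $G(t)$ is the directed multigraph on $\Sigma$ with one edge $t_i\to t_{i+1}$ for each $1\le i<n$; a word $s=s_1\cdots s_k$ is an Eulerian trail of $G(t)$ if the multiset of pairs $\{(s_i,s_{i+1}):1\le i<k\}$ equals the multiset $\{(t_i,t_{i+1}):1\le i<n\}$. The language $L$ consists of the empty word $\epsilon$ together with all nonempty words $t$ such that no word $s\neq t$ with $s_1=t_1$ is an Eulerian trail of $G(t)$. A word $r$ is a minimal forbidden word of $L$ if $r\notin L$ while every proper factor (contiguous subword) of $r$ belongs to $L$. -}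

module Defs where

open import Data.List.Base using (List; []; _∷_; _++_; [_]; head)
open import Data.List.Membership.Propositional using (_∉_)
open import Data.List.Relation.Binary.Disjoint.Propositional using (Disjoint)
open import Data.List.Relation.Binary.Infix.Heterogeneous using (Infix)
open import Data.List.Relation.Binary.Permutation.Propositional using (_↭_)
open import Data.Product.Base using (_×_; _,_; ∃-syntax)
open import Data.Sum.Base using (_⊎_)
open import Level using (Level)
open import Relation.Binary.PropositionalEquality using (_≡_; _≢_)
open import Relation.Nullary.Negation using (¬_)
open import Relation.Unary using (Pred)

private
  variable
    ℓ : Level
    A : Set ℓ

Word : Set ℓ → Set ℓ
Word = List

-- A directed multigraph on the vertex set A is given by its list of edges;
-- since multiplicity matters but order does not, such lists are only ever
-- compared up to permutation.
Multigraph : Set ℓ → Set ℓ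
Multigraph A = List (A × A)

steps : Word A → List (A × A)
steps []          = []
steps (_ ∷ [])    = []
steps (c ∷ d ∷ w) = (c , d) ∷ steps (d ∷ w)

G : Word A → Multigraph A
G = steps

EulerianTrail : Multigraph A → Word A → Set _
EulerianTrail E s = steps s ↭ E

data L {A : Set ℓ} : Pred (Word A) ℓ where
  empty    : L []
  nonempty : ∀ {c w} →
             (let t = c ∷ w) →
             ¬ (∃[ s ] (s ≢ t × head s ≡ head t × EulerianTrail (G t) s)) →
             L t

ProperFactor : Word A → Word A → Set _
ProperFactor u r = Infix _≡_ u r × u ≢ r

MinimalForbidden : Pred (Word A) ℓ → Pred (Word A) _
MinimalForbidden K r = ¬ K r × (∀ u → ProperFactor u r → K u)

record Conditions {A : Set ℓ} (a b : A) (x y z : Word A) : Set ℓ where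
  field
    x≢ε⊎y≢ε : x ≢ [] ⊎ y ≢ []
    x∈L : L x
    y∈L : L y
    z∈L : L z
    a∉x : a ∉ x
    a∉y : a ∉ y
    a∉z : a ∉ z
    b∉x : b ∉ x
    b∉y : b ∉ y
    b∉z : b ∉ z
    x#y : Disjoint x y
    x#z : Disjoint x z
    y#z : Disjoint y z

data L″ {A : Set ℓ} : Pred (Word A) ℓ where
  formA : ∀ {a b x y z} → a ≢ b → Conditions a b x y z →
          L″ ([ a ] ++ x ++ [ b ] ++ z ++ [ a ] ++ y ++ [ b ])
  -- A single letter plays the roles of both a and b here.
  formB : ∀ {a x y} → Conditions a a x y [] →
          L″ ([ a ] ++ x ++ [ a ] ++ y ++ [ a ])

{-# OPTIONS --safe #-}
module Submission where

-- Suppose another trail with the same start leaves w = c ∷ … by a different first step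
-- c → e, and split w at a step c → e as c loop c e rest. The other trail must come
-- back to c, which is possible only if loop ∪ {c} and e rest share a letter b. Then w
-- contains c x b z c y b (or c x c y c), and exchanging x and y really gives a second
-- trail. So words of L are those without such a detour at any position; this makes L
-- closed under factors and under concatenation of words with disjoint alphabets, and so
-- puts all proper factors of a word of L″ into L.
-- Conversely, a minimal forbidden word has a detour at its first letter. Taking for b
-- the first shared letter gives the required shape. A further coincidence between the
-- letters of a, b, x, y, z would exhibit an exchange within a proper factor; being in
-- L, the factor must be unchanged by it, and comparing first occurrences of two letters
-- on both sides yields a contradiction.

open import Defs
open import Data.Empty using (⊥; ⊥-elim)
open import Data.Fin.Base using (Fin)
open import Data.Fin.Properties using () renaming (_≟_ to _≟ᶠ_)
open import Data.List.Base using (List; []; _∷_; _++_; [_]; head; initLast; _∷ʳ′_)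
open import Data.List.Membership.Propositional using (_∈_; _∉_; find; lose)
open import Data.List.Membership.Propositional.Properties
  using (∈-++⁺ˡ; ∈-++⁺ʳ; ∈-++⁻; ∈-insert; ∈-∃++)
open import Data.List.Properties
  using (≡-dec; ++-assoc; ++-identityʳ; ++-identityʳ-unique; ∷ʳ-injective; ∷-injective)
open import Data.List.Relation.Binary.Disjoint.Propositional using (Disjoint)
open import Data.List.Relation.Binary.Infix.Heterogeneous
  using (Infix; View; there; MkView; toView; fromView)
open import Data.List.Relation.Binary.Permutation.Propositional
  using (_↭_; ↭-sym; ↭-trans; prep)
open import Data.List.Relation.Binary.Permutation.Propositional.Properties
  using (↭-empty-inv; ∈-resp-↭; ++⁺ˡ; shifts; drop-∷)
open import Data.List.Relation.Binary.Pointwise using (≡⇒Pointwise-≡; Pointwise-≡⇒≡)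
open import Data.List.Relation.Unary.Any using (Any; here; there; any?)
open import Data.Maybe.Base using (just)
open import Data.Maybe.Properties using (just-injective) renaming (≡-dec to ≡-decᵐ)
open import Data.Nat.Base using (ℕ)
open import Data.Product.Base using (_×_; _,_; ∃-syntax; ∃₂; proj₁; proj₂)
open import Data.Sum.Base using (_⊎_; inj₁; inj₂; [_,_]′)
open import Function.Base using (case_of_)
open import Function.Bundles using (_↔_)
open import Function.Properties.Inverse using (↔⇒↣)
open import Level using (Level)
open import Relation.Binary.Definitions using (DecidableEquality)
open import Relation.Binary.PropositionalEquality
  using (_≡_; _≢_; refl; sym; trans; cong; subst; subst₂; ≢-sym)
open import Relation.Nullary.Decidable
  using (Dec; yes; no; map′; _⊎-dec_; _×-dec_; ¬?; decidable-stable; via-injection)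
open import Relation.Nullary.Negation using (¬_; contradiction)
open import Relation.Unary using (_≐_)

private
  variable
    ℓ ℓ′ : Level
    A : Set ℓ
    a b c e : A
    p q u v w x y z : List A

-- Letters, disjointness and decompositions of words at marked letters.

∉-++⁺ : ∀ (u : List A) → a ∉ u → a ∉ v → a ∉ u ++ v
∉-++⁺ u a∉u a∉v a∈ = [ a∉u , a∉v ]′ (∈-++⁻ u a∈)

∉-∷⁺ : a ≢ b → a ∉ v → a ∉ b ∷ v
∉-∷⁺ a≢b a∉v (here a≡b)  = a≢b a≡b
∉-∷⁺ a≢b a∉v (there a∈v) = a∉v a∈v

∉⇒≢ : a ∉ v → b ∈ v → a ≢ b
∉⇒≢ a∉v b∈v refl = a∉v b∈v

#-++⁺ʳ : ∀ {x u v : List A} → Disjoint x u → Disjoint x v → Disjoint x (u ++ v)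
#-++⁺ʳ {u = u} x#u x#v (m , n) = [ (λ i → x#u (m , i)) , (λ i → x#v (m , i)) ]′ (∈-++⁻ u n)

#-∷⁺ʳ : b ∉ x → Disjoint x v → Disjoint x (b ∷ v)
#-∷⁺ʳ b∉x x#v (m , here refl) = b∉x m
#-∷⁺ʳ b∉x x#v (m , there n)   = x#v (m , n)

#-[]ʳ : Disjoint x []
#-[]ʳ (_ , ())

#⇒≢ : x ≢ [] ⊎ y ≢ [] → Disjoint x y → x ≢ y
#⇒≢ {x = []}    (inj₁ x≢[]) _   refl = x≢[] refl
#⇒≢ {x = []}    (inj₂ y≢[]) _   refl = y≢[] refl
#⇒≢ {x = _ ∷ _} _           x#y refl = x#y (here refl , here refl)

head-++∷ : ∀ (u : List A) → head (u ++ b ∷ v) ≡ head (u ++ b ∷ w)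
head-++∷ []      = refl
head-++∷ (_ ∷ _) = refl

-- If one prefix ended earlier, its mark would be a letter of the other prefix; the crossed
-- hypotheses exclude this.
first-occurrence-unique : ∀ (u v : List A) → u ++ a ∷ p ≡ v ++ b ∷ q → a ∉ v → b ∉ u →
                          u ≡ v × a ≡ b × p ≡ q
first-occurrence-unique []      []      eq   a∉v b∉u = refl , ∷-injective eq
first-occurrence-unique []      (_ ∷ v) refl a∉v b∉u = ⊥-elim (a∉v (here refl))
first-occurrence-unique (_ ∷ u) []      refl a∉v b∉u = ⊥-elim (b∉u (here refl))
first-occurrence-unique (_ ∷ u) (_ ∷ v) eq   a∉v b∉u with ∷-injective eq
... | refl , eq′ with first-occurrence-unique u v eq′ (λ m → a∉v (there m)) (λ m → b∉u (there m))
...   | refl , rest = refl , rest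

-- Only the left-hand side needs hypotheses: an `a` marked elsewhere on the right would fall into
-- `u` or `v`.
only-occurrence-unique : ∀ (u p : List A) → u ++ a ∷ v ≡ p ++ a ∷ q → a ∉ u → a ∉ v →
                         u ≡ p × v ≡ q
only-occurrence-unique []      []      refl a∉u a∉v = refl , refl
only-occurrence-unique []      (_ ∷ p) refl a∉u a∉v = ⊥-elim (a∉v (∈-insert p))
only-occurrence-unique (_ ∷ u) []      refl a∉u a∉v = ⊥-elim (a∉u (here refl))
only-occurrence-unique (_ ∷ u) (_ ∷ p) eq   a∉u a∉v with ∷-injective eq
... | refl , eq′ with only-occurrence-unique u p eq′ (λ m → a∉u (there m)) a∉v
...   | refl , rest = refl , rest

++-∷-split : ∀ (u p : List A) → u ++ v ≡ p ++ a ∷ q → a ∉ v →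
             ∃[ r ] u ≡ p ++ a ∷ r × q ≡ r ++ v
++-∷-split []      p       refl a∉v = ⊥-elim (a∉v (∈-insert p))
++-∷-split (_ ∷ u) []      refl a∉v = u , refl , refl
++-∷-split (_ ∷ u) (_ ∷ p) eq   a∉v with ∷-injective eq
... | refl , eq′ with ++-∷-split u p eq′ a∉v
...   | r , refl , eq″ = r , refl , eq″

first-split : {P : A → Set ℓ′} → (∀ a → Dec (P a)) → ∀ {w} → Any P w →
              ∃[ u ] ∃[ b ] ∃[ v ] w ≡ u ++ b ∷ v × (∀ {a} → a ∈ u → ¬ P a) × P b
first-split P? {c ∷ w} i with P? c
... | yes Pc = [] , c , w , refl , (λ ()) , Pc
first-split P? {c ∷ w} (here Pc) | no ¬Pc = contradiction Pc ¬Pc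
first-split P? {c ∷ w} (there i) | no ¬Pc with first-split P? i
... | u , b , v , refl , none , Pb =
  c ∷ u , b , v , refl , (λ { (here refl) → ¬Pc ; (there m) → none m }) , Pb

-- For a letter shared by a detour: either it is the final `c` closing the loop, or it lies inside
-- the loop. The two forms of words in `L″` stem from this.
∷ʳ-split : ∀ (p x : List A) {z} → p ++ [ c ] ≡ x ++ b ∷ z → (p ≡ x × c ≡ b) ⊎ ∃[ z′ ] p ≡ x ++ b ∷ z′
∷ʳ-split p x {z} eq with initLast z
... | []      = inj₁ (∷ʳ-injective p x eq)
... | z′ ∷ʳ′ d = inj₂ (z′ , proj₁ (∷ʳ-injective p _ (trans eq (sym (++-assoc x _ _)))))

++-assoc₃ : ∀ (x y z : List A) {w} → (x ++ y ++ z) ++ w ≡ x ++ y ++ z ++ w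
++-assoc₃ x y z = trans (++-assoc x (y ++ z) _) (cong (x ++_) (++-assoc y z _))

-- Read from the left, one side meets `a` before `b` and the other `b` before `a`. This refutes
-- equations forced by an exchange.
different-marks : a ≢ b → ∀ (u v : List A) → a ∉ v → b ∉ u → u ++ a ∷ p ≢ v ++ b ∷ q
different-marks a≢b u v a∉v b∉u eq = a≢b (proj₁ (proj₂ (first-occurrence-unique u v eq a∉v b∉u)))

same-mark : ∀ (u v : List A) → a ∉ u → a ∉ v → u ++ a ∷ p ≡ v ++ a ∷ q → u ≡ v
same-mark u v a∉u a∉v eq = proj₁ (first-occurrence-unique u v eq a∉v a∉u)

↭-swap-outer : ∀ (x z y : List A) {v} → x ++ z ++ y ++ v ↭ y ++ z ++ x ++ v
↭-swap-outer x z y = ↭-trans (shifts x z) (↭-trans (++⁺ˡ z (shifts x y)) (shifts z y))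

split? : {P : List A → List A → Set ℓ′} → (∀ p q → Dec (P p q)) →
         ∀ w → Dec (∃₂ λ p q → w ≡ p ++ q × P p q)
split? P? []      = map′ (λ h → [] , [] , refl , h)
                         (λ { ([] , [] , refl , h) → h }) (P? [] [])
split? P? (c ∷ w) = map′
  [ (λ h → [] , _ , refl , h) , (λ { (p , q , refl , h) → c ∷ p , q , refl , h }) ]′
  (λ { ([] , _ , refl , h) → inj₁ h ; (_ ∷ p , q , refl , h) → inj₂ (p , q , refl , h) })
  (P? [] (c ∷ w) ⊎-dec split? (λ p → P? (c ∷ p)) w)

-- Steps of concatenated words and exchanges that preserve them.

steps-++ : ∀ u (c : A) v → steps (u ++ c ∷ v) ≡ steps (u ++ [ c ]) ++ steps (c ∷ v)
steps-++ []          c v = refl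
steps-++ (_ ∷ [])    c v = refl
steps-++ (b ∷ d ∷ u) c v = cong ((b , d) ∷_) (steps-++ (d ∷ u) c v)

step-split : ∀ (w : List A) → (a , b) ∈ steps w → ∃₂ λ p q → w ≡ p ++ a ∷ b ∷ q
step-split (_ ∷ _ ∷ w) (here refl) = [] , w , refl
step-split (c ∷ d ∷ w) (there m) with step-split (d ∷ w) m
... | p , q , eq = c ∷ p , q , cong (c ∷_) eq

step-source : ∀ (w : List A) → (a , b) ∈ steps w → a ∈ w
step-source (_ ∷ _ ∷ w) (here refl) = here refl
step-source (_ ∷ d ∷ w) (there m)   = there (step-source (d ∷ w) m)

step-target : ∀ (w : List A) → (a , b) ∈ steps w → b ∈ w
step-target (_ ∷ _ ∷ w) (here refl) = there (here refl)
step-target (_ ∷ d ∷ w) (there m)   = there (step-target (d ∷ w) m)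

step-++⁻ : ∀ (u : List A) → (a , b) ∈ steps (u ++ v) → a ∈ u ⊎ (a , b) ∈ steps v
step-++⁻                []          m           = inj₂ m
step-++⁻ {v = _ ∷ _} (_ ∷ [])    (here refl) = inj₁ (here refl)
step-++⁻ {v = _ ∷ _} (_ ∷ [])    (there m)   = inj₂ m
step-++⁻                (_ ∷ _ ∷ u) (here refl) = inj₁ (here refl)
step-++⁻                (_ ∷ d ∷ u) (there m)   =
  [ (λ i → inj₁ (there i)) , inj₂ ]′ (step-++⁻ (d ∷ u) m)

walk-closed : ∀ {X : List A} s → (∀ {a b} → (a , b) ∈ steps (e ∷ s) → a ∈ X → b ∈ X) →
              e ∈ X → c ∈ e ∷ s → c ∈ X
walk-closed s       closed e∈X (here refl) = e∈X
walk-closed (d ∷ s) closed e∈X (there m)   =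
  walk-closed s (λ i → closed (there i)) (closed (here refl) e∈X) m

-- Cutting at each `a` splits the steps into blocks, and the exchange only permutes the two closed
-- walks at `a`. In `swap-trails` the blocks are two arcs from `a` to `b` around a way back.
swap-letters : ∀ (a : A) x y v → steps (a ∷ x ++ a ∷ y ++ a ∷ v) ↭ steps (a ∷ y ++ a ∷ x ++ a ∷ v)
swap-letters a x y v = subst₂ _↭_ (sym (expand x y)) (sym (expand y x))
  (shifts (steps (a ∷ x ++ [ a ])) (steps (a ∷ y ++ [ a ])))
  where
  expand : ∀ x y → steps (a ∷ x ++ a ∷ y ++ a ∷ v) ≡
                   steps (a ∷ x ++ [ a ]) ++ steps (a ∷ y ++ [ a ]) ++ steps (a ∷ v)
  expand x y = trans (steps-++ (a ∷ x) a _) (cong (_ ++_) (steps-++ (a ∷ y) a v))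

swap-trails : ∀ (a b : A) x z y v → steps (a ∷ x ++ b ∷ z ++ a ∷ y ++ b ∷ v) ↭
                                    steps (a ∷ y ++ b ∷ z ++ a ∷ x ++ b ∷ v)
swap-trails a b x z y v = subst₂ _↭_ (sym (expand x y)) (sym (expand y x))
  (↭-swap-outer (steps (a ∷ x ++ [ b ])) (steps (b ∷ z ++ [ a ])) (steps (a ∷ y ++ [ b ])))
  where
  expand : ∀ x y → steps (a ∷ x ++ b ∷ z ++ a ∷ y ++ b ∷ v) ≡
                   steps (a ∷ x ++ [ b ]) ++ steps (b ∷ z ++ [ a ]) ++
                   steps (a ∷ y ++ [ b ]) ++ steps (b ∷ v)
  expand x y = trans (steps-++ (a ∷ x) b _) (cong (_ ++_)
              (trans (steps-++ (b ∷ z) a _) (cong (_ ++_) (steps-++ (a ∷ y) b v))))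

-- Detours, and their absence from words of `L`.

L-unique : ∀ {c : A} {s w} → L (c ∷ w) → steps (c ∷ s) ↭ steps (c ∷ w) → ¬ (s ≢ w)
L-unique (nonempty h) perm s≢w = h (_ , (λ { refl → s≢w refl }) , refl , perm)

L-tail : L (c ∷ w) → L w
L-tail {w = []}    _            = empty
L-tail {w = d ∷ w} (nonempty h) = nonempty λ
  { ([]    , _ , () , _)
  ; (_ ∷ s , s≢ , refl , perm) → h (_ , (λ { refl → s≢ refl }) , refl , prep _ perm) }

L-suffix : ∀ (u : List A) → L (u ++ v) → L v
L-suffix []      h = h
L-suffix (_ ∷ u) h = L-suffix u (L-tail h)

-- The appended `c` in `shared` lets a third visit to `c` count as sharing; this is the case that
-- leads to `formB`. The loop may be empty, and then `differ` says that `exit` is not `c`.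
record Detour {ℓ} {A : Set ℓ} (c : A) (w : List A) : Set ℓ where
  constructor detour
  field
    loop   : List A
    exit   : A
    rest   : List A
    split  : w ≡ loop ++ c ∷ exit ∷ rest
    differ : head w ≢ just exit
    shared : Any (_∈ exit ∷ rest) (loop ++ [ c ])

mkDetour : ∀ p → w ≡ p ++ c ∷ e ∷ q → head w ≢ just e → b ∈ p ++ [ c ] → b ∈ e ∷ q → Detour c w
mkDetour p split differ b∈ b∈′ = detour p _ _ split differ (lose b∈ b∈′)

Detour⇒∈ : Detour c w → c ∈ w
Detour⇒∈ (detour p _ _ refl _ _) = ∈-insert p

Detour-++ : ∀ v → Detour c w → Detour c (w ++ v)
Detour-++ v (detour p e q refl differ shared) with find shared
... | b , b∈ , b∈′ = mkDetour p (++-assoc p _ v)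
  (λ eq → differ (trans (head-++∷ p) (trans (sym (cong head (++-assoc p _ v))) eq))) b∈ (∈-++⁺ˡ b∈′)

-- Cutting at a shared letter `b` exposes two arcs to exchange. The exchanged word begins with the
-- step from `c` to `e`, even if the arc `y` is empty, since then `b` is `e`; by `differ` it is a
-- new trail.
L⇒¬Detour : L (c ∷ w) → ¬ Detour c w
L⇒¬Detour {c = c} h (detour p e q split differ shared) with find shared
... | b , b∈ , b∈′ with ∈-∃++ b∈ | ∈-∃++ b∈′
... | x , z , eq | y , v , eq′ with ∷ʳ-split p x eq
... | inj₁ (refl , refl) with refl ← trans split (cong (λ t → p ++ b ∷ t) eq′) =
  L-unique h (swap-letters b y p v) λ s≡w → differ (trans (sym (cong head s≡w))
    (trans (head-++∷ y) (sym (cong head eq′))))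
... | inj₂ (z , refl) with refl ← trans split (trans (++-assoc x _ _) (cong (λ t → x ++ b ∷ z ++ c ∷ t) eq′)) =
  L-unique h (swap-trails c b y z x v) λ s≡w → differ (trans (sym (cong head s≡w))
    (trans (head-++∷ y) (sym (cong head eq′))))

-- The detour criterion and closure properties of `L`.

module _ {A : Set ℓ} (_≟_ : DecidableEquality A) where

  open import Data.List.Membership.DecPropositional _≟_ using (_∈?_)

  no-other-trail : ∀ {c : A} {w} → L w → ¬ Detour c w →
                   ¬ (∃[ s ] (s ≢ c ∷ w × head s ≡ head (c ∷ w) × EulerianTrail (G (c ∷ w)) s))
  no-other-trail {w = w}     h ¬detour ([] , _ , () , _)
  no-other-trail {w = []}    h ¬detour (_ ∷ [] , s≢ , refl , _) = s≢ refl
  no-other-trail {w = []}    h ¬detour (_ ∷ e ∷ s , _ , refl , perm) with () ← ↭-empty-inv perm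
  no-other-trail {w = d ∷ w} h ¬detour (_ ∷ [] , _ , refl , perm) with () ← ↭-empty-inv (↭-sym perm)
  no-other-trail {c} {d ∷ w} h ¬detour (_ ∷ e ∷ s , s≢ , refl , perm) with d ≟ e
  ... | yes refl = L-unique h (drop-∷ perm) λ { refl → s≢ refl }
  ... | no d≢e with ∈-resp-↭ perm (here refl) | ∈-resp-↭ (↭-sym perm) (here refl)
  ...   | here refl | _         = d≢e refl
  ...   | there _   | here refl = d≢e refl
  ...   | there ce∈ | there cd∈ with step-split (d ∷ w) ce∈
  -- The other trail still has to use the step from `c` to `d`, so it visits `c`. But once at `e` it
  -- is confined to the letters of `e ∷ q`, and `c` among them would be shared.
  ...     | p , q , split = no-detour (∈-++⁺ʳ p (here refl))
              (walk-closed s closed (here refl) (step-source (e ∷ s) cd∈))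
    where
    no-detour : ∀ {b} → b ∈ p ++ [ c ] → b ∈ e ∷ q → ⊥
    no-detour b∈ b∈′ = ¬detour (mkDetour p split (λ eq → d≢e (just-injective eq)) b∈ b∈′)

    steps-split : steps (c ∷ d ∷ w) ≡ steps ((c ∷ p ++ [ c ]) ++ e ∷ q)
    steps-split = cong (λ t → steps (c ∷ t)) (trans split (sym (++-assoc p [ c ] (e ∷ q))))

    closed : ∀ {a b} → (a , b) ∈ steps (e ∷ s) → a ∈ e ∷ q → b ∈ e ∷ q
    -- Every step of the other trail is an edge of `c ∷ d ∷ w`. Its source lies in `e ∷ q`, hence
    -- not before `e` without being shared, so the edge lies within `e ∷ q`.
    closed {a} ab∈ a∈ with step-++⁻ {a = a} (c ∷ p ++ [ c ])
                         (subst (_ ∈_) steps-split (∈-resp-↭ perm (there ab∈)))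
    ... | inj₁ (here refl) = ⊥-elim (no-detour (∈-++⁺ʳ p (here refl)) a∈)
    ... | inj₁ (there a∈′) = ⊥-elim (no-detour a∈′ a∈)
    ... | inj₂ ab∈′        = step-target (e ∷ q) ab∈′

  L-∷⁺ : ∀ {c : A} {w} → L w → ¬ Detour c w → L (c ∷ w)
  L-∷⁺ h ¬detour = nonempty (no-other-trail h ¬detour)

  L-prefix : ∀ (u : List A) {v} → L (u ++ v) → L u
  L-prefix []      h = empty
  L-prefix (c ∷ u) h = L-∷⁺ (L-prefix u (L-tail h)) (λ δ → L⇒¬Detour h (Detour-++ _ δ))

  L-∉ : ∀ {c : A} {w} → c ∉ w → L w → L (c ∷ w)
  L-∉ c∉w h = L-∷⁺ h (λ δ → c∉w (Detour⇒∈ δ))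

  -- A detour from a letter `c` of `u` must return to `c` within `u`. If its shared letter recurs in
  -- `v`, disjointness fails; otherwise the detour already exists in `u`.
  L-++⁺ : ∀ {u v : List A} → L u → L v → Disjoint u v → L (u ++ v)
  L-++⁺ {[]}    _ k _ = k
  L-++⁺ {c ∷ u} {v} h k u#v = L-∷⁺ (L-++⁺ (L-tail h) k (λ (m , n) → u#v (there m , n))) no-detour
    where
    no-detour : ¬ Detour c (u ++ v)
    no-detour (detour p e q split differ shared)
      with find shared | ++-∷-split u p split (λ m → u#v (here refl , m))
    ... | b , b∈ , b∈′ | [] , refl , refl =
      [ (λ m → u#v (there (∈-++⁺ˡ m) , b∈′)) , (λ { (here refl) → u#v (here refl , b∈′) }) ]′ (∈-++⁻ p b∈)
    ... | b , b∈ , b∈′ | _ ∷ r , refl , refl with ∈-++⁻ (e ∷ r) b∈′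
    ...   | inj₁ m = L⇒¬Detour h (mkDetour p refl
              (λ eq → differ (trans (cong head (++-assoc p _ v)) (trans (head-++∷ p) eq))) b∈ m)
    ...   | inj₂ m = [ (λ m′ → u#v (there (∈-++⁺ˡ m′) , m)) , (λ { (here refl) → u#v (here refl , m) }) ]′ (∈-++⁻ p b∈)

  -- With a single return to `c`, the only candidate loop is `u` and the only continuation is `v`;
  -- they share nothing.
  L-return : ∀ {c : A} {u v} → c ∉ u → c ∉ v → Disjoint u v → L (u ++ c ∷ v) → L (c ∷ u ++ c ∷ v)
  L-return {c} {u} {v} c∉u c∉v u#v h = L-∷⁺ h no-detour
    where
    no-detour : ¬ Detour c (u ++ c ∷ v)
    no-detour (detour p e q split _ shared)
      with find shared | only-occurrence-unique u p split c∉u c∉v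
    ... | b , b∈ , b∈′ | refl , refl =
      [ (λ m → u#v (m , b∈′)) , (λ { (here refl) → c∉v b∈′ }) ]′ (∈-++⁻ p b∈)

  -- Turns failure of membership in `L` into an explicit detour, by searching all splittings of `w`.
  detour? : ∀ c (w : List A) → Dec (Detour c w)
  detour? c w = map′ (λ { (p , _ , split , e , q , refl , differ , shared) → detour p e q split differ shared })
                     (λ { (detour p e q split differ shared) → p , _ , split , e , q , refl , differ , shared })
                     (split? at? w)
    where
    At : List A → List A → Set _
    At p r = ∃[ e ] ∃[ q ] r ≡ c ∷ e ∷ q × head w ≢ just e × Any (_∈ e ∷ q) (p ++ [ c ])

    at? : ∀ p r → Dec (At p r)
    at? p []       = no λ ()
    at? p (_ ∷ []) = no λ ()
    at? p (c′ ∷ e ∷ q) = map′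
      (λ { (refl , differ , shared) → e , q , refl , differ , shared })
      (λ { (_ , _ , refl , differ , shared) → refl , differ , shared })
      ((c′ ≟ c) ×-dec ¬? (≡-decᵐ _≟_ (head w) (just e)) ×-dec any? (_∈? (e ∷ q)) (p ++ [ c ]))

  -- Extreme occurrences, and exchanges inside words of `L`.

  last-occurrence : ∀ {a : A} {w} → a ∈ w → ∃₂ λ u v → w ≡ u ++ a ∷ v × a ∉ v
  last-occurrence {a} {c ∷ w} m with a ∈? w | m
  ... | yes a∈w | _          with u , v , refl , a∉v ← last-occurrence a∈w = c ∷ u , v , refl , a∉v
  ... | no a∉w  | here refl  = [] , w , refl , a∉w
  ... | no a∉w  | there a∈w  = contradiction a∈w a∉w

  first-occurrence : ∀ {a : A} {w} → a ∈ w → ∃₂ λ u v → w ≡ u ++ a ∷ v × a ∉ u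
  first-occurrence {a} m with first-split (a ≟_) m
  ... | u , _ , v , refl , none , refl = u , v , refl , λ a∈u → none a∈u refl

  -- Uniqueness only yields a double negation; decidable equality of words turns it into an
  -- equation.
  L⇒swap-letters : ∀ {a : A} x y v → L (a ∷ x ++ a ∷ y ++ a ∷ v) →
                   x ++ a ∷ y ++ a ∷ v ≡ y ++ a ∷ x ++ a ∷ v
  L⇒swap-letters x y v h =
    sym (decidable-stable (≡-dec _≟_ _ _) (L-unique h (swap-letters _ y x v)))

  L⇒swap-trails : ∀ {a b : A} x z y v → L (a ∷ x ++ b ∷ z ++ a ∷ y ++ b ∷ v) →
                  x ++ b ∷ z ++ a ∷ y ++ b ∷ v ≡ y ++ b ∷ z ++ a ∷ x ++ b ∷ v
  L⇒swap-trails x z y v h =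
    sym (decidable-stable (≡-dec _≟_ _ _) (L-unique h (swap-trails _ _ y z x v)))

  -- Words of `L″` are minimal forbidden.

  -- A proper factor misses the first or the last letter, so only two maximal proper factors have to
  -- be checked.
  proper-factor-L : ∀ {u : List A} {a} m b → L (a ∷ m) → L (m ++ [ b ]) →
                    ProperFactor u (a ∷ m ++ [ b ]) → L u
  proper-factor-L {u} {a} m b init-L tail-L (infix′ , u≢) with splitInfix infix′
    where
    splitInfix : ∀ {u r : List A} → Infix _≡_ u r → ∃₂ λ o v → r ≡ o ++ u ++ v
    splitInfix i with MkView o u≋ v ← toView i with refl ← Pointwise-≡⇒≡ u≋ = o , v , refl
  ... | _ ∷ o , v , eq =
    L-prefix u (L-suffix o (subst L (proj₂ (∷-injective eq)) tail-L))
  ... | [] , v , eq with initLast v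
  ...   | []       = contradiction (sym (trans eq (++-identityʳ u))) u≢
  ...   | v ∷ʳ′ d  = L-prefix u (subst L
            (proj₁ (∷ʳ-injective (a ∷ m) (u ++ v) (trans eq (sym (++-assoc u v [ d ]))))) init-L)

  L″⇒MinimalForbidden : ∀ {r : List A} → L″ r → MinimalForbidden L r
  L″⇒MinimalForbidden (formA {a} {b} {x} {y} {z} a≢b cond) = forbidden , λ u u∝r →
    -- In `a x b z a y` the letter `a` returns just once; in the part `b z a y b` of the other
    -- maximal factor, so does `b`. Hence `L-return` applies to each, and disjointness supplies the
    -- rest.
    proper-factor-L (x ++ b ∷ z ++ a ∷ y) b
      (subst (λ t → L (a ∷ t)) (++-assoc x (b ∷ z) (a ∷ y))
        (L-return (∉-++⁺ x a∉x (∉-∷⁺ a≢b a∉z)) a∉y xbz#y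
          (subst L (sym (++-assoc x (b ∷ z) (a ∷ y)))
            (L-++⁺ x∈L
              (L-∉ (∉-++⁺ z b∉z (∉-∷⁺ (≢-sym a≢b) b∉y)) (L-++⁺ z∈L (L-∉ a∉y y∈L) z#ay))
              (#-∷⁺ʳ b∉x (#-++⁺ʳ x#z (#-∷⁺ʳ a∉x x#y)))))))
      (subst L (sym (++-assoc₃ x (b ∷ z) (a ∷ y)))
        (L-++⁺ x∈L
          (subst (λ t → L (b ∷ t)) (++-assoc z (a ∷ y) [ b ])
            (L-return (∉-++⁺ z b∉z (∉-∷⁺ (≢-sym a≢b) b∉y)) (λ ()) #-[]ʳ
              (subst L (sym (++-assoc z (a ∷ y) [ b ]))
                (L-++⁺ z∈L
                  (L-∉ (∉-++⁺ y a∉y (∉-∷⁺ a≢b λ ()))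
                    (L-++⁺ y∈L (L-∉ (λ ()) empty) (#-∷⁺ʳ b∉y #-[]ʳ)))
                  (#-∷⁺ʳ a∉z (#-++⁺ʳ z#y (#-∷⁺ʳ b∉z #-[]ʳ)))))))
          (#-∷⁺ʳ b∉x (#-++⁺ʳ x#z (#-∷⁺ʳ a∉x (#-++⁺ʳ x#y (#-∷⁺ʳ b∉x #-[]ʳ)))))))
      (subst (ProperFactor u) (cong (a ∷_) (sym (++-assoc₃ x (b ∷ z) (a ∷ y)))) u∝r)
    where
    open Conditions cond
    z#y : Disjoint z y
    z#y (m , n) = y#z (n , m)
    z#ay : Disjoint z (a ∷ y)
    z#ay = #-∷⁺ʳ a∉z z#y
    xbz#y : Disjoint (x ++ b ∷ z) y
    xbz#y (m , n) = [ (λ i → x#y (i , n)) , (λ { (here refl) → b∉y n ; (there i) → y#z (n , i) }) ]′ (∈-++⁻ x m)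
    forbidden : ¬ L (a ∷ x ++ b ∷ z ++ a ∷ y ++ [ b ])
    forbidden h = #⇒≢ x≢ε⊎y≢ε x#y (same-mark x y b∉x b∉y (L⇒swap-trails x z y [] h))
  L″⇒MinimalForbidden (formB {a} {x} {y} cond) = forbidden , λ u u∝r →
    proper-factor-L (x ++ a ∷ y) a
      (L-return a∉x a∉y x#y (L-++⁺ x∈L (L-∉ a∉y y∈L) (#-∷⁺ʳ a∉x x#y)))
      (subst L (sym (++-assoc x (a ∷ y) [ a ]))
        (L-++⁺ x∈L
          (L-return a∉y (λ ()) #-[]ʳ (L-++⁺ y∈L (L-∉ (λ ()) empty) (#-∷⁺ʳ a∉y #-[]ʳ)))
          (#-∷⁺ʳ a∉x (#-++⁺ʳ x#y (#-∷⁺ʳ a∉x #-[]ʳ)))))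
      (subst (ProperFactor u) (cong (a ∷_) (sym (++-assoc x (a ∷ y) [ a ]))) u∝r)
    where
    open Conditions cond
    forbidden : ¬ L (a ∷ x ++ a ∷ y ++ [ a ])
    forbidden h = #⇒≢ x≢ε⊎y≢ε x#y (same-mark x y a∉x a∉y (L⇒swap-letters x y [] h))

  -- Minimal forbidden words lie in `L″`.

  MinimalForbidden-tail : ∀ {c : A} {w} → MinimalForbidden L (c ∷ w) → L w
  MinimalForbidden-tail (_ , minimal) =
    minimal _ (there (fromView (subst (View _≡_ _) (++-identityʳ _) (MkView [] (≡⇒Pointwise-≡ refl) []))) , λ ())

  MinimalForbidden-prefix : ∀ {r : List A} u {d v} → r ≡ u ++ d ∷ v → MinimalForbidden L r → L u
  MinimalForbidden-prefix u refl (_ , minimal) =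
    minimal u (fromView (MkView [] (≡⇒Pointwise-≡ refl) _) , λ eq → case ++-identityʳ-unique u eq of λ ())

  -- The tail `v` and, in `outer`, the possibility that `b` is `c` are still allowed; minimality
  -- removes both later.
  data FirstDetour (c : A) : List A → Set ℓ where
    inner : ∀ {x y v} → c ∉ x → c ∉ y → Disjoint x y → x ≢ [] ⊎ y ≢ [] →
            FirstDetour c (x ++ c ∷ y ++ c ∷ v)
    outer : ∀ {b x y z v} → b ∉ x → b ∉ y → Disjoint x y → x ≢ [] ⊎ y ≢ [] →
            FirstDetour c (x ++ b ∷ z ++ c ∷ y ++ b ∷ v)

  nonempty-arc : ∀ {b e : A} {u v q} x y → e ∷ q ≡ y ++ b ∷ v → head (x ++ b ∷ u) ≢ just e → x ≢ [] ⊎ y ≢ []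
  nonempty-arc (_ ∷ _) _       _    _      = inj₁ λ ()
  nonempty-arc []      (_ ∷ _) _    _      = inj₂ λ ()
  nonempty-arc []      []      refl differ = contradiction refl differ

  -- Taking `b` as the first shared letter of the loop keeps `x` free of all letters of `e ∷ q`;
  -- taking its first occurrence there keeps `b` out of `y`.
  firstDetour : ∀ {c : A} {w} → Detour c w → FirstDetour c w
  firstDetour {c} (detour p e q split differ shared)
    with x , b , z , eq , x#eq , b∈eq ← first-split (_∈? (e ∷ q)) shared
    with y , v , eq′ , b∉y ← first-occurrence b∈eq
    with ∷ʳ-split p x eq
  ... | inj₁ (refl , refl) with refl ← trans split (cong (λ t → p ++ b ∷ t) eq′) =
    inner (λ m → x#eq m b∈eq) b∉y
      (λ (m , n) → x#eq m (subst (_ ∈_) (sym eq′) (∈-++⁺ˡ n))) (nonempty-arc x y eq′ differ)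
  ... | inj₂ (z , refl)
    with refl ← trans split (trans (++-assoc x _ _) (cong (λ t → x ++ b ∷ z ++ c ∷ t) eq′)) =
    outer (λ m → x#eq m b∈eq) b∉y
      (λ (m , n) → x#eq m (subst (_ ∈_) (sym eq′) (∈-++⁺ˡ n))) (nonempty-arc x y eq′ differ)

  minimal-conditions : ∀ {a b : A} {x y z} → a ≢ b → b ∉ x → b ∉ y → Disjoint x y → x ≢ [] ⊎ y ≢ [] →
                       L (a ∷ x ++ b ∷ z ++ a ∷ y) → L (x ++ b ∷ z ++ a ∷ y ++ [ b ]) →
                       Conditions a b x y z
  minimal-conditions {a} {b} {x} {y} {z} a≢b b∉x b∉y x#y arcs≢[] init-L tail-L = record
    { x≢ε⊎y≢ε = arcs≢[]
    ; x∈L = L-prefix x tail-L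
    ; y∈L = L-tail ayL
    ; z∈L = L-prefix z zayL
    ; a∉x = a∉x
    ; a∉y = a∉y
    ; a∉z = a∉z
    ; b∉x = b∉x
    ; b∉y = b∉y
    ; b∉z = b∉z
    ; x#y = x#y
    ; x#z = x#z
    ; y#z = y#z
    }
    where
    b≢a : b ≢ a
    b≢a = ≢-sym a≢b

    zayL : L (z ++ a ∷ y)
    zayL = L-tail (L-suffix x (L-tail init-L))

    ayL : L (a ∷ y)
    ayL = L-suffix z zayL

    a∉x : a ∉ x
    -- The closed walks `x₁` and `x₂ b z` at `a` are exchanged; the choice of the last `a` keeps
    -- `x₂` free of `a`.
    a∉x a∈x with x₁ , x₂ , refl , a∉x₂ ← last-occurrence a∈x =
      different-marks a≢b x₁ x₂ a∉x₂ (λ m → b∉x (∈-++⁺ˡ m))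
        (trans (L⇒swap-letters x₁ (x₂ ++ b ∷ z) y
                 (subst (λ t → L (a ∷ t))
                   (trans (++-assoc x₁ _ _) (cong (λ t → x₁ ++ a ∷ t) (sym (++-assoc x₂ (b ∷ z) (a ∷ y)))))
                   init-L))
               (++-assoc x₂ (b ∷ z) _))

    a∉y : a ∉ y
    a∉y a∈y with y₁ , y₂ , refl , _ ← last-occurrence a∈y =
      -- Here the closed walks at `a` are `x b z` and `y₁`.
      different-marks b≢a x y₁ (λ m → b∉y (∈-++⁺ˡ m)) a∉x
        (trans (sym (++-assoc x (b ∷ z) _))
          (L⇒swap-letters (x ++ b ∷ z) y₁ y₂
            (subst (λ t → L (a ∷ t)) (sym (++-assoc x (b ∷ z) _)) init-L)))

    a∉z : a ∉ z
    a∉z a∈z with z₁ , z₂ , refl , _ ← last-occurrence a∈z with b ∈? z₂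
    ... | no b∉z₂ =
      different-marks b≢a x z₂ b∉z₂ a∉x
        (trans (sym (++-assoc x (b ∷ z₁) _))
          (L⇒swap-letters (x ++ b ∷ z₁) z₂ y
            (subst (λ t → L (a ∷ t))
              (trans (cong (λ t → x ++ b ∷ t) (++-assoc z₁ (a ∷ z₂) (a ∷ y))) (sym (++-assoc x (b ∷ z₁) _)))
              init-L)))
    -- Now `x`, `z₃`, `y` are three arcs from `a` to `b`. Exchanging the first two avoids the last
    -- letter of the word, exchanging the last two avoids its first letter, so all three coincide.
    ... | yes b∈z₂ with z₃ , z₄ , refl , b∉z₃ ← first-occurrence b∈z₂ =
      #⇒≢ arcs≢[] x#y (trans x≡z₃ z₃≡y)
      where
      z-assoc : ∀ t → (z₁ ++ a ∷ z₃ ++ b ∷ z₄) ++ t ≡ z₁ ++ a ∷ z₃ ++ b ∷ z₄ ++ t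
      z-assoc _ = ++-assoc₃ z₁ (a ∷ z₃) (b ∷ z₄)

      x≡z₃ : x ≡ z₃
      x≡z₃ = same-mark x z₃ b∉x b∉z₃
        (L⇒swap-trails x z₁ z₃ (z₄ ++ a ∷ y)
          (subst (λ t → L (a ∷ x ++ b ∷ t)) (z-assoc (a ∷ y)) init-L))

      z₃≡y : z₃ ≡ y
      z₃≡y = same-mark z₃ y b∉z₃ b∉y
        (L⇒swap-trails z₃ z₄ y []
          (L-suffix z₁ (subst L (z-assoc _) (L-tail (L-suffix x tail-L)))))

    b∉z : b ∉ z
    b∉z b∈z with z₁ , z₂ , refl , b∉z₂ ← last-occurrence b∈z =
      different-marks b≢a z₁ z₂ b∉z₂ (λ m → a∉z (∈-++⁺ˡ m))
        (trans (L⇒swap-letters z₁ (z₂ ++ a ∷ y) []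
                 (subst (λ t → L (b ∷ t))
                   (trans (++-assoc z₁ _ _) (cong (λ t → z₁ ++ b ∷ t) (sym (++-assoc z₂ (a ∷ y) _))))
                   (L-suffix x tail-L)))
               (++-assoc z₂ (a ∷ y) _))

    x#z : Disjoint x z
    x#z {g} (m , n) with x₁ , x₂ , refl , _ ← last-occurrence m | z₁ , z₂ , refl , _ ← last-occurrence n =
      -- Two arcs lead from `g` to `b`, namely `x₂` and `z₂ a y`, joined by `b z₁ g`.
      different-marks b≢a x₂ z₂ (λ i → b∉z (∈-++⁺ʳ z₁ (there i))) (λ i → a∉x (∈-++⁺ʳ x₁ (there i)))
        (trans (L⇒swap-trails x₂ z₁ (z₂ ++ a ∷ y) []
                 (subst (λ t → L (g ∷ x₂ ++ b ∷ t))
                   (trans (++-assoc z₁ _ _) (cong (λ t → z₁ ++ g ∷ t) (sym (++-assoc z₂ (a ∷ y) _))))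
                   (L-suffix x₁ (subst L (++-assoc x₁ _ _) tail-L))))
               (++-assoc z₂ (a ∷ y) _))

    y#z : Disjoint y z
    y#z {g} (m , n) with y₁ , y₂ , refl , _ ← last-occurrence m | z₁ , z₂ , refl , _ ← last-occurrence n =
      -- Two arcs lead from `a` to `g`, namely `x b z₁` and `y₁`, joined by `g z₂ a`.
      different-marks (∉⇒≢ b∉y m) x y₁ (λ i → b∉y (∈-++⁺ˡ i)) (λ i → x#y (i , m))
        (trans (sym (++-assoc x (b ∷ z₁) _))
          (L⇒swap-trails (x ++ b ∷ z₁) z₂ y₁ y₂
            (subst (λ t → L (a ∷ t))
              (trans (cong (λ t → x ++ b ∷ t) (++-assoc z₁ (g ∷ z₂) _)) (sym (++-assoc x (b ∷ z₁) _)))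
              init-L)))

  -- Since `z` may itself contain `c`, neither arc need equal `z`; but both equal the part of
  -- `z ++ [ c ]` before its first `c`.
  equal-arcs : ∀ {c : A} {p p′ q q′} x y z → c ∉ x → c ∉ y →
               x ++ c ∷ p ≡ z ++ c ∷ p′ → y ++ c ∷ q ≡ z ++ c ∷ q′ → x ≡ y
  equal-arcs {c} x y z c∉x c∉y eq eq′
    with u , v , zc≡ , c∉u ← first-occurrence (∈-++⁺ʳ z {[ c ]} (here refl)) =
    trans (same-mark x u c∉x c∉u (trans eq (first-c _))) (sym (same-mark y u c∉y c∉u (trans eq′ (first-c _))))
    where
    first-c : ∀ t → z ++ c ∷ t ≡ u ++ c ∷ v ++ t
    first-c t = trans (sym (++-assoc z [ c ] t)) (trans (cong (_++ t) zc≡) (++-assoc u (c ∷ v) t))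

  MinimalForbidden⇒L″ : ∀ {r : List A} → MinimalForbidden L r → L″ r
  MinimalForbidden⇒L″ {[]}    (∉L , _) = contradiction empty ∉L
  MinimalForbidden⇒L″ {c ∷ w} r@(∉L , _) with detour? c w
  ... | no ¬δ = contradiction (L-∷⁺ (MinimalForbidden-tail r) ¬δ) ∉L
  ... | yes δ with firstDetour δ
  ...   | inner {x} {y} {[]} c∉x c∉y x#y arcs≢[] = formB record
          { x≢ε⊎y≢ε = arcs≢[]
          ; x∈L = L-prefix x tail-L
          ; y∈L = L-prefix y (L-tail (L-suffix x tail-L))
          ; z∈L = empty
          ; a∉x = c∉x
          ; a∉y = c∉y
          ; a∉z = λ ()
          ; b∉x = c∉x
          ; b∉y = c∉y
          ; b∉z = λ ()
          ; x#y = x#y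
          ; x#z = #-[]ʳ
          ; y#z = #-[]ʳ
          }
          where
          tail-L : L (x ++ c ∷ y ++ [ c ])
          tail-L = MinimalForbidden-tail r
  -- A nonempty remainder would make the forbidden shape a proper prefix, contradicting minimality.
  ...   | inner {x} {y} {d ∷ v} c∉x c∉y x#y arcs≢[] =
          contradiction (same-mark x y c∉x c∉y (L⇒swap-letters x y [] prefix-L)) (#⇒≢ arcs≢[] x#y)
          where
          prefix-L : L (c ∷ x ++ c ∷ y ++ [ c ])
          prefix-L = MinimalForbidden-prefix _ (sym (++-assoc₃ (c ∷ x) (c ∷ y) [ c ])) r
  ...   | outer {b} {x} {y} {z} {d ∷ v} b∉x b∉y x#y arcs≢[] =
          contradiction (same-mark x y b∉x b∉y (L⇒swap-trails x z y [] prefix-L)) (#⇒≢ arcs≢[] x#y)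
          where
          prefix-L : L (c ∷ x ++ b ∷ z ++ c ∷ y ++ [ b ])
          prefix-L = MinimalForbidden-prefix _
            (sym (trans (++-assoc₃ (c ∷ x) (b ∷ z) (c ∷ y ++ [ b ]))
                        (cong (λ t → c ∷ x ++ b ∷ z ++ c ∷ t) (++-assoc y [ b ] _)))) r
  ...   | outer {b} {x} {y} {z} {[]} b∉x b∉y x#y arcs≢[] with c ≟ b
  ...     | no c≢b = formA c≢b (minimal-conditions c≢b b∉x b∉y x#y arcs≢[]
              (MinimalForbidden-prefix _ (sym (++-assoc₃ (c ∷ x) (b ∷ z) (c ∷ y))) r)
              (MinimalForbidden-tail r))
  -- The word is `c x c z c y c`. Without its last letter it allows exchanging `x` and `z`, without
  -- its first part `c x` exchanging `z` and `y`.
  ...     | yes refl = contradiction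
              (equal-arcs x y z b∉x b∉y
                (L⇒swap-letters x z y (MinimalForbidden-prefix _ (sym (++-assoc₃ (c ∷ x) (c ∷ z) (c ∷ y))) r))
                (sym (L⇒swap-letters z y [] (L-suffix x (MinimalForbidden-tail r)))))
              (#⇒≢ arcs≢[] x#y)

theorem1 : ∀ {ℓ : Level} (A : Set ℓ) (n : ℕ) → A ↔ Fin n →
    L″ {A = A} ≐ MinimalForbidden (L {A = A})
theorem1 A n A↔Fin = L″⇒MinimalForbidden _≟_ , MinimalForbidden⇒L″ _≟_
  where
  _≟_ : DecidableEquality A
  _≟_ = via-injection (↔⇒↣ A↔Fin) _≟ᶠ_
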